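{- Let $S_N$ denote the $N$-th large Schröder number and $C_N=\frac{1}{N+1}\binom{2N}{N}$ the $N$-th Catalan number. For every non-negative integer $n$, $$v_3(S_{2n+1})=v_3(C_n),\qquad v_3(S_{2n+2})=1+v_3(2n+1)+v_3(C_n).$$
   Context: The large Schröder number $S_N$ is the number of lattice paths from $(0,0)$ to $(N,N)$ using steps $(1,0)$, $(0,1)$, $(1,1)$ that never go above the diagonal $y=x$ (so $S_0=1,S_1=2,S_2=6,\dots$). $v_3(y)$ denotes the $3$-adic valuation of a nonzero integer $y$. -}

module Defs where

open import Data.List.Base using (List; []; _∷_; [_]; _++_; map; length)
open import Data.List.Membership.Propositional using (_∈_)
open import Data.List.Membership.Propositional.Properties
  using (∈-map⁺; ∈-map⁻; ∈-++⁺ˡ; ∈-++⁺ʳ; ∈-++⁻)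
open import Data.List.Relation.Unary.All using ([])
open import Data.List.Relation.Unary.Any using (here; there)
open import Data.List.Relation.Unary.Unique.Propositional using (Unique; []; _∷_)
import Data.List.Relation.Unary.Unique.Propositional.Properties as Unique
open import Data.Nat.Base
open import Data.Nat.Combinatorics using (_C_; nCn≡1; nCk+nC[k+1]≡[n+1]C[k+1])
open import Data.Nat.Coprimality using (Coprime; coprime-divisor)
open import Data.Nat.Divisibility
open import Data.Nat.DivMod using (_/_; m/n*n≡m)
open import Data.Nat.Properties
open import Data.Nat.Tactic.RingSolver using (solve-∀)
open import Data.Product.Base using (_×_; _,_)
open import Data.Sum.Base using (_⊎_; inj₁; inj₂)
open import Relation.Binary.PropositionalEquality
  using (_≡_; refl; sym; trans; cong; cong₂; subst; module ≡-Reasoning)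
open import Relation.Nullary using (Dec; yes; no; ¬_; contradiction)

------------------------------------------------------------------------
-- Large Schröder numbers

-- Lattice paths from (0,0) to (x,y) that never go above the line y = x.
-- Only a north step can leave the region y ≤ x, so only that step
-- carries a condition.
data Path : ℕ → ℕ → Set where
  origin : Path 0 0
  east   : ∀ {x y} → Path x y → Path (suc x) y
  north  : ∀ {x y} → suc y ≤ x → Path x y → Path x (suc y)
  diag   : ∀ {x y} → Path x y → Path (suc x) (suc y)

map-north : ∀ {x y} → Dec (suc y ≤ x) → List (Path x y) → List (Path x (suc y))
map-north (yes y<x) ps = map (north y<x) ps
map-north (no  _)   ps = []

paths : ∀ x y → List (Path x y)
paths zero    zero    = [ origin ]
paths zero    (suc y) = []
paths (suc x) zero    = map east (paths x zero)
paths (suc x) (suc y) = map east (paths x (suc y))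
                     ++ map-north (suc y ≤? suc x) (paths (suc x) y)
                     ++ map diag (paths x y)

-- By `paths-complete` and `paths-unique` below, every path occurs in
-- `paths n n` exactly once, so this is the number of paths.
S : ℕ → ℕ
S n = length (paths n n)

private
  ∈-map-north⁺ : ∀ {x y} (d : Dec (suc y ≤ x)) (y<x : suc y ≤ x) {p : Path x y} {ps} →
                 p ∈ ps → north y<x p ∈ map-north d ps
  ∈-map-north⁺ (yes q) y<x p∈ps rewrite ≤-irrelevant y<x q = ∈-map⁺ (north q) p∈ps
  ∈-map-north⁺ (no ¬q) y<x p∈ps = contradiction y<x ¬q

  east-injective : ∀ {x y} {p q : Path x y} → east p ≡ east q → p ≡ q
  east-injective refl = refl

  north-injective : ∀ {x y} {y<x : suc y ≤ x} {p q : Path x y} →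
                    north y<x p ≡ north y<x q → p ≡ q
  north-injective refl = refl

  diag-injective : ∀ {x y} {p q : Path x y} → diag p ≡ diag q → p ≡ q
  diag-injective refl = refl

  map-north-unique : ∀ {x y} (d : Dec (suc y ≤ x)) {ps : List (Path x y)} →
                     Unique ps → Unique (map-north d ps)
  map-north-unique (yes _) u = Unique.map⁺ north-injective u
  map-north-unique (no  _) u = []

  north≢diag : ∀ {x y} (d : Dec (suc y ≤ suc x)) {ps : List (Path (suc x) y)}
               {qs : List (Path x y)} {r} →
               ¬ (r ∈ map-north d ps × r ∈ map diag qs)
  north≢diag (yes q) (i , j) with ∈-map⁻ (north q) i | ∈-map⁻ diag j
  ... | _ , _ , refl | _ , _ , ()
  north≢diag (no _) (() , _)

  east≢north : ∀ {x y} (d : Dec (suc y ≤ suc x)) {ps : List (Path x (suc y))}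
               {qs : List (Path (suc x) y)} {r} →
               ¬ (r ∈ map east ps × r ∈ map-north d qs)
  east≢north (yes q) (i , j) with ∈-map⁻ east i | ∈-map⁻ (north q) j
  ... | _ , _ , refl | _ , _ , ()
  east≢north (no _) (_ , ())

  east≢diag : ∀ {x y} {ps : List (Path x (suc y))} {qs : List (Path x y)} {r} →
              ¬ (r ∈ map east ps × r ∈ map diag qs)
  east≢diag (i , j) with ∈-map⁻ east i | ∈-map⁻ diag j
  ... | _ , _ , refl | _ , _ , ()

paths-complete : ∀ {x y} (p : Path x y) → p ∈ paths x y
paths-complete origin                      = here refl
paths-complete (east {y = zero}  p)        = ∈-map⁺ east (paths-complete p)
paths-complete (east {y = suc y} p)        = ∈-++⁺ˡ (∈-map⁺ east (paths-complete p))
paths-complete (north {suc x} {y} y<x p)   =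
  ∈-++⁺ʳ (map east (paths x (suc y)))
    (∈-++⁺ˡ (∈-map-north⁺ (suc y ≤? suc x) y<x (paths-complete p)))
paths-complete (diag {x} {y} p)            =
  ∈-++⁺ʳ (map east (paths x (suc y)))
    (∈-++⁺ʳ (map-north (suc y ≤? suc x) (paths (suc x) y))
      (∈-map⁺ diag (paths-complete p)))

paths-unique : ∀ x y → Unique (paths x y)
paths-unique zero    zero    = [] ∷ []
paths-unique zero    (suc y) = []
paths-unique (suc x) zero    = Unique.map⁺ east-injective (paths-unique x zero)
paths-unique (suc x) (suc y) =
  Unique.++⁺ (Unique.map⁺ east-injective (paths-unique x (suc y)))
    (Unique.++⁺ (map-north-unique d (paths-unique (suc x) y))
                (Unique.map⁺ diag-injective (paths-unique x y))
                (north≢diag d))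
    λ (i , j) → disjoint i (∈-++⁻ (map-north d (paths (suc x) y)) j)
  where
  d = suc y ≤? suc x
  disjoint : ∀ {r} → r ∈ map east (paths x (suc y)) →
             ¬ (r ∈ map-north d (paths (suc x) y) ⊎ r ∈ map diag (paths x y))
  disjoint i (inj₁ j) = east≢north d (i , j)
  disjoint i (inj₂ j) = east≢diag (i , j)

S-nonZero : ∀ n → NonZero (S n)
S-nonZero n = ∈⇒nonZero (paths-complete (diagonal n))
  where
  diagonal : ∀ n → Path n n
  diagonal zero    = origin
  diagonal (suc n) = diag (diagonal n)

  ∈⇒nonZero : ∀ {x y} {p : Path x y} {ps} → p ∈ ps → NonZero (length ps)
  ∈⇒nonZero (here _)  = _
  ∈⇒nonZero (there _) = _

------------------------------------------------------------------------
-- Catalan numbers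

-- The division is exact: see `suc*catalan`.
catalan : ℕ → ℕ
catalan n = ((2 * n) C n) / suc n

private
  absorption : ∀ n k → suc k * (suc n C suc k) ≡ suc n * (n C k)
  absorption zero    zero    = refl
  absorption zero    (suc k) = *-zeroʳ (suc (suc k))
  absorption (suc n) zero    = begin
    1 * (suc (suc n) C 1)            ≡⟨ *-identityˡ _ ⟩
    suc (suc n) C 1                  ≡⟨ nCk+nC[k+1]≡[n+1]C[k+1] (suc n) 0 ⟨
    1 + (suc n C 1)                  ≡⟨ cong (1 +_) (*-identityˡ (suc n C 1)) ⟨
    1 + 1 * (suc n C 1)              ≡⟨ cong (1 +_) (absorption n 0) ⟩
    1 + suc n * (n C 0)              ≡⟨⟩
    suc (suc n) * (suc n C 0)        ∎
    where open ≡-Reasoning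
  absorption (suc n) (suc k) = begin
    suc (suc k) * (suc (suc n) C suc (suc k))
      ≡⟨ cong (suc (suc k) *_) (nCk+nC[k+1]≡[n+1]C[k+1] (suc n) (suc k)) ⟨
    suc (suc k) * (a + b)
      ≡⟨ expand k a b ⟩
    a + (suc k * a + suc (suc k) * b)
      ≡⟨ cong (a +_) (cong₂ _+_ (absorption n k) (absorption n (suc k))) ⟩
    a + (suc n * (n C k) + suc n * (n C suc k))
      ≡⟨ cong (a +_) (*-distribˡ-+ (suc n) (n C k) (n C suc k)) ⟨
    a + suc n * ((n C k) + (n C suc k))
      ≡⟨ cong (λ c → a + suc n * c) (nCk+nC[k+1]≡[n+1]C[k+1] n k) ⟩
    suc (suc n) * a ∎
    where
    open ≡-Reasoning
    a = suc n C suc k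
    b = suc n C suc (suc k)
    expand : ∀ k a b → suc (suc k) * (a + b) ≡ a + (suc k * a + suc (suc k) * b)
    expand = solve-∀

  nCk>0 : ∀ {n k} → k ≤ n → n C k > 0
  nCk>0 {n}     {zero}  z≤n       = s≤s z≤n
  nCk>0 {suc n} {suc k} (s≤s k≤n) =
    subst (_> 0) (nCk+nC[k+1]≡[n+1]C[k+1] n k) (≤-trans (nCk>0 k≤n) (m≤m+n _ _))

  suc∣2nCn : ∀ n → suc n ∣ (2 * n) C n
  suc∣2nCn n = coprime-divisor coprime
    (divides (suc (2 * n) C suc n)
      (trans (sym (absorption (2 * n) n)) (*-comm (suc n) _)))
    where
    double : ∀ n → 2 * suc n ≡ suc (2 * n) + 1
    double = solve-∀
    coprime : Coprime (suc n) (suc (2 * n))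
    coprime {d} (d∣m , d∣n) =
      ∣1⇒≡1 (∣m+n∣m⇒∣n (subst (d ∣_) (double n) (∣n⇒∣m*n 2 d∣m)) d∣n)

suc*catalan : ∀ n → suc n * catalan n ≡ (2 * n) C n
suc*catalan n = trans (*-comm (suc n) _) (m/n*n≡m (suc∣2nCn n))

catalan-nonZero : ∀ n → NonZero (catalan n)
catalan-nonZero n = m*n≢0⇒n≢0 (suc n)
  {{subst NonZero (sym (suc*catalan n)) (>-nonZero (nCk>0 (m≤n*m n 2)))}}

------------------------------------------------------------------------
-- Valuations

-- The largest e ≤ b such that p ^ e divides n.
largestExponent : (p n b : ℕ) → ℕ
largestExponent p n zero    = zero
largestExponent p n (suc b) with p ^ suc b ∣? n
... | yes _ = suc b
... | no  _ = largestExponent p n b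

-- Since n < p ^ n for p ≥ 2, searching up to n loses nothing: see
-- `valuation-greatest`.
valuation : (p n : ℕ) .{{_ : NonZero n}} → ℕ
valuation p n = largestExponent p n n

v₃ : (n : ℕ) .{{_ : NonZero n}} → ℕ
v₃ = valuation 3

private
  largestExponent-∣ : ∀ p n b → p ^ largestExponent p n b ∣ n
  largestExponent-∣ p n zero    = 1∣ n
  largestExponent-∣ p n (suc b) with p ^ suc b ∣? n
  ... | yes pᵇ∣n = pᵇ∣n
  ... | no  _    = largestExponent-∣ p n b

  largestExponent-greatest : ∀ p n b {e} → e ≤ b → p ^ e ∣ n → e ≤ largestExponent p n b
  largestExponent-greatest p n zero    e≤b _ = e≤b
  largestExponent-greatest p n (suc b) {e} e≤1+b pᵉ∣n with p ^ suc b ∣? n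
  ... | yes _ = e≤1+b
  ... | no ¬d with m≤n⇒m<n∨m≡n e≤1+b
  ...   | inj₁ (s≤s e≤b) = largestExponent-greatest p n b e≤b pᵉ∣n
  ...   | inj₂ refl      = contradiction pᵉ∣n ¬d

  n<p^n : ∀ p .{{_ : NonTrivial p}} n → n < p ^ n
  n<p^n p zero    = s≤s z≤n
  n<p^n p (suc n) = ≤-<-trans (n<p^n p n) (^-monoʳ-< p (nonTrivial⇒n>1 p) (n<1+n n))

valuation-∣ : ∀ p n .{{_ : NonZero n}} → p ^ valuation p n ∣ n
valuation-∣ p n = largestExponent-∣ p n n

valuation-greatest : ∀ p n .{{_ : NonTrivial p}} .{{_ : NonZero n}} {e} →
                     p ^ e ∣ n → e ≤ valuation p n
valuation-greatest p n {e} pᵉ∣n =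
  largestExponent-greatest p n n (<⇒≤ (<-≤-trans (n<p^n p e) (∣⇒≤ pᵉ∣n))) pᵉ∣n

{-# OPTIONS --safe #-}

-- Expanding √((1+x²)-6x) in powers of 6x gives 2^(N+1) S_N as an alternating sum of
-- integers times powers of 3. For N = 2n+1 its first term is ±C_n, for N = 2n+2 it is
-- ±3·2(2n+1)C_n; consecutive terms have a simple ratio, from which every later term is
-- divisible by a higher power of 3 than the first one. The expansion satisfies the
-- recurrence (N+1)S_N = 3(2N-1)S_{N-1} - (N-2)S_{N-2} term by term, and the
-- recurrence itself comes from S_N = D(N,N) - D(N+1,N-1) with Delannoy numbers D.

module Submission where

open import Defs
open import Data.Integer.Base as ℤ using (ℤ; +_; -_; _-_; ∣_∣)
import Data.Integer.Divisibility.Signed as Signed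
import Data.Integer.Properties as ℤ
import Data.Integer.Tactic.RingSolver as ℤSolver
open import Data.List.Base using (map; length)
open import Data.List.Properties using (length-map; length-++)
open import Data.Nat.Base hiding (∣_-_∣)
open import Data.Nat.Combinatorics using (_C_; nCk+nC[k+1]≡[n+1]C[k+1]; k>n⇒nCk≡0)
open import Data.Nat.Divisibility
open import Data.Nat.DivMod using (_/_; _%_; m≡m%n+[m/n]*n; m%n<n)
open import Data.Nat.Induction using (<-rec)
open import Data.Nat.Primality using (Prime; prime?; prime⇒nonZero; euclidsLemma)
open import Data.Nat.Properties
open import Data.Nat.Tactic.RingSolver using (solve-∀)
open import Data.Product.Base using (_×_; _,_; proj₁; proj₂; ∃-syntax)
open import Data.Sum.Base using (inj₁; inj₂; [_,_]′)
open import Function.Base using (_∘_)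
open import Relation.Binary.PropositionalEquality
open import Relation.Nullary using (Dec; yes; no; ¬_; contradiction)
open import Relation.Nullary.Decidable using (from-yes; from-no)

-- Divisibility by powers of 3

-- The ratio of consecutive terms is not integral: its denominator is (k+1)(k+2). Weighting the
-- coefficients by k! clears it, so the first term divides k! times every later coefficient. The
-- price is v₃(k!) ≤ k/2, while 9^i contributes 2i against k = 2i or k = 2i + 1; for i ≥ 1 a gain of
-- at least one factor 3 remains. The parity of N decides whether the powers of 3 start at 3^0 or at
-- 3^1, which is the source of the extra 1 in the second formula.

infix 4 _^_∥_
-- Carrying the cofactor makes a `NonZero` instance unnecessary, so this applies to `∣ oddSum n ∣`
-- before that number is known to be nonzero.
_^_∥_ : ℕ → ℕ → ℕ → Set
p ^ e ∥ n = ∃[ u ] n ≡ p ^ e * u × ¬ p ∣ u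

n≢0⇒p^v∥n : ∀ p n .{{_ : NonTrivial p}} .{{_ : NonZero n}} → p ^ valuation p n ∥ n
n≢0⇒p^v∥n p n with valuation-∣ p n
... | divides u n≡u*pᵛ = u , trans n≡u*pᵛ (*-comm u _) , λ p∣u →
  <-irrefl refl (valuation-greatest p n
    (subst (p ^ suc (valuation p n) ∣_) (sym n≡u*pᵛ) (*-monoˡ-∣ (p ^ valuation p n) p∣u)))

module _ {p} (p-prime : Prime p) where
  private instance
    p-nonZero : NonZero p
    p-nonZero = prime⇒nonZero p-prime

  ∤⇒∦ : ∀ {e n} → p ^ 0 ∥ n → ¬ p ^ suc e ∥ n
  ∤⇒∦ {e} (u , refl , p∤u) (w , eq , _) = p∤u (subst (p ∣_) (trans (sym eq) (*-identityˡ u))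
    (∣m⇒∣m*n w (m∣m*n (p ^ e))))

  -- Valuations are compared through this: the two sides of each claimed equation turn out to be
  -- exact exponents of 3 in the same integer.
  ∥-unique : ∀ a b {n} → p ^ a ∥ n → p ^ b ∥ n → a ≡ b
  ∥-unique zero    zero    _ _ = refl
  ∥-unique zero    (suc b) h k = contradiction k (∤⇒∦ {b} h)
  ∥-unique (suc a) zero    h k = contradiction h (∤⇒∦ {a} k)
  ∥-unique (suc a) (suc b) (u , refl , p∤u) (w , eq , p∤w) = cong suc (∥-unique a b (u , refl , p∤u)
    (w , *-cancelˡ-≡ _ _ p (trans (sym (*-assoc p _ u)) (trans eq (*-assoc p _ w))) , p∤w))

  ∥-* : ∀ a b {m n} → p ^ a ∥ m → p ^ b ∥ n → p ^ (a + b) ∥ m * n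
  ∥-* a b (u , refl , p∤u) (w , refl , p∤w) =
    u * w ,
    trans ([m*n]*[o*p]≡[m*o]*[n*p] (p ^ a) u (p ^ b) w)
          (cong (_* (u * w)) (sym (^-distribˡ-+-* p a b))) ,
    λ p∣uw → [ p∤u , p∤w ]′ (euclidsLemma u w p-prime p∣uw)

  ∤⇒p^0∥ : ∀ {n} → ¬ p ∣ n → p ^ 0 ∥ n
  ∤⇒p^0∥ {n} p∤n = n , sym (*-identityˡ n) , p∤n

  p^e∣u*n⇒p^e∣n : ∀ e {u n} → ¬ p ∣ u → p ^ e ∣ u * n → p ^ e ∣ n
  p^e∣u*n⇒p^e∣n zero    p∤u _ = 1∣ _
  p^e∣u*n⇒p^e∣n (suc e) {u} {n} p∤u d with euclidsLemma u n p-prime (∣-trans (m∣m*n (p ^ e)) d)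
  ... | inj₁ p∣u = contradiction p∣u p∤u
  ... | inj₂ (divides n′ refl) = subst (p ^ suc e ∣_) (*-comm p n′) (*-monoʳ-∣ p
          (p^e∣u*n⇒p^e∣n e p∤u (*-cancelˡ-∣ p (subst (p ^ suc e ∣_) (rearrange u n′ p) d))))
    where
    rearrange : ∀ u n p → u * (n * p) ≡ p * (u * n)
    rearrange = solve-∀

-- A dominant term decides the valuation: taking out p^e leaves u - qp, which is congruent to u
-- modulo p. Here n will be the first term of a sum and r the whole tail.
∥-subtract : ∀ {p} e {n} {r : ℤ} → p ^ e ∥ n → + (p ^ suc e) Signed.∣ r → p ^ e ∥ ∣ + n - r ∣
∥-subtract {p} e (u , refl , p∤u) (Signed.divides q refl) =
  ∣ + u - q ℤ.* + p ∣ ,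
  trans (cong ∣_∣ factor) (ℤ.abs-* (+ (p ^ e)) _) ,
  λ p∣ → p∤u (Signed.∣⇒∣ᵤ {+ p} {+ u}
           (Signed.∣m+n∣n⇒∣m {m = + u} (Signed.∣ᵤ⇒∣ p∣) (Signed.∣m⇒∣-m (Signed.∣n⇒∣m*n q Signed.∣-refl))))
  where
  rearrange : ∀ x u q p → x ℤ.* u - q ℤ.* (p ℤ.* x) ≡ x ℤ.* (u - q ℤ.* p)
  rearrange = ℤSolver.solve-∀
  factor : + (p ^ e * u) - q ℤ.* + (p ^ suc e) ≡ + (p ^ e) ℤ.* (+ u - q ℤ.* + p)
  factor = trans (cong₂ (λ x y → x - q ℤ.* y) (ℤ.pos-* (p ^ e) u) (ℤ.pos-* p (p ^ e)))
                 (rearrange (+ (p ^ e)) (+ u) q (+ p))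

3-prime : Prime 3
3-prime = from-yes (prime? 3)

3∤3q+ : ∀ r q → ¬ 3 ∣ suc r → ¬ 3 ∣ suc r + q * 3
3∤3q+ r q 3∤r 3∣ = 3∤r (∣m+n∣m⇒∣n (subst (3 ∣_) (+-comm (suc r) (q * 3)) 3∣) (n∣m*n q))

-- The multiples of 3 in (3q)! contribute 3^q q!, everything else is prime to 3.
[q*3]! : ∀ q → ∃[ u ] (q * 3) ! ≡ 3 ^ q * u * q ! × ¬ 3 ∣ u
[q*3]! zero    = 1 , refl , from-no (3 ∣? 1)
[q*3]! (suc q) with [q*3]! q
... | u , eq , 3∤u = (2 + q * 3) * (1 + q * 3) * u , eq′ ,
    λ 3∣ → [ (λ 3∣₁ → [ 3∤3q+ 1 q (from-no (3 ∣? 2)) , 3∤3q+ 0 q (from-no (3 ∣? 1)) ]′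
                       (euclidsLemma (2 + q * 3) _ 3-prime 3∣₁)) , 3∤u ]′
           (euclidsLemma ((2 + q * 3) * (1 + q * 3)) u 3-prime 3∣)
  where
  rearrange : ∀ q x u f → (3 + q * 3) * ((2 + q * 3) * ((1 + q * 3) * (x * u * f)))
            ≡ 3 * x * ((2 + q * 3) * (1 + q * 3) * u) * ((1 + q) * f)
  rearrange = solve-∀
  eq′ : (3 + q * 3) ! ≡ 3 ^ suc q * ((2 + q * 3) * (1 + q * 3) * u) * (suc q) !
  eq′ = trans (cong (λ f → (3 + q * 3) * ((2 + q * 3) * ((1 + q * 3) * f))) eq)
              (rearrange q (3 ^ q) u (q !))

-- Legendre's bound v₃(n!) ≤ n/2. Factors prime to 3 leave the exponent alone, so only n = 3q
-- matters; there the exponent is q + e with 2e ≤ q, and 2q + q = 3q.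
3^e∥n! : ∀ n → ∃[ e ] 2 * e ≤ n × 3 ^ e ∥ n !
3^e∥n! = <-rec _ λ n rec → go n rec (n % 3) (n / 3) (m≡m%n+[m/n]*n n 3) (m%n<n n 3)
  where
  P : ℕ → Set
  P n = ∃[ e ] 2 * e ≤ n × 3 ^ e ∥ n !

  triple : ∀ q → P q → P (q * 3)
  triple q (e , 2e≤q , 3^e∥q!) with [q*3]! q
  ... | u , eq , 3∤u = q + e ,
    subst₂ _≤_ (sym (*-distribˡ-+ 2 q e)) (lemma q) (+-monoʳ-≤ (2 * q) 2e≤q) ,
    subst (3 ^ (q + e) ∥_) (sym eq) (∥-* 3-prime q e (u , refl , 3∤u) 3^e∥q!)
    where
    lemma : ∀ q → 2 * q + q ≡ q * 3
    lemma = solve-∀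

  extend : ∀ {n} → ¬ 3 ∣ suc n → P n → P (suc n)
  extend 3∤ (e , 2e≤n , h) = e , m≤n⇒m≤1+n 2e≤n , ∥-* 3-prime 0 e (∤⇒p^0∥ 3-prime 3∤) h

  go : ∀ n → (∀ {m} → m < n → P m) → ∀ r q → n ≡ r + q * 3 → r < 3 → P n
  go _ rec 0 zero    refl _ = 0 , z≤n , 1 , refl , from-no (3 ∣? 1)
  go _ rec 0 (suc q) refl _ = triple (suc q) (rec (m<m*n (suc q) 3 (s≤s (s≤s z≤n))))
  go _ rec 1 q refl _ = extend (3∤3q+ 0 q (from-no (3 ∣? 1))) (rec ≤-refl)
  go _ rec 2 q refl _ = extend (3∤3q+ 1 q (from-no (3 ∣? 2))) (rec ≤-refl)
  go _ rec (suc (suc (suc r))) q _ (s≤s (s≤s (s≤s ())))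

-- 2v₃(N!) ≤ N ≤ 2(i+1)+1 forces v₃(N!) ≤ i+1, so 9^(i+1) supplies at least i+1 further factors 3.
3^e∣N!h⇒3^[1+e]∣9^ih : ∀ e i N h → N ≤ 1 + 2 * suc i → 3 ^ e ∣ N ! * h → 3 ^ suc e ∣ 9 ^ suc i * h
3^e∣N!h⇒3^[1+e]∣9^ih e i N h N≤ d with 3^e∥n! N
... | a , 2a≤N , u , N!≡ , 3∤u =
  -- One factor 3 yields the additional exponent, 3^(i+1) pays for 3^a, and 3^i is given away.
  subst (3 ^ suc e ∣_) (sym 9^≡) (*-monoʳ-∣ 3 (∣n⇒∣m*n (3 ^ i)
    (∣-trans 3^e∣ (*-monoˡ-∣ h (m≤n⇒m^a∣ (a≤ a (≤-trans 2a≤N N≤)))))))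
  where
  m≤n⇒m^a∣ : a ≤ suc i → 3 ^ a ∣ 3 ^ suc i
  m≤n⇒m^a∣ a≤ = subst (3 ^ a ∣_)
    (trans (sym (^-distribˡ-+-* 3 a (suc i ∸ a))) (cong (3 ^_) (m+[n∸m]≡n a≤))) (m∣m*n _)
  a≤ : ∀ a → 2 * a ≤ 1 + 2 * suc i → a ≤ suc i
  a≤ a h = ≮⇒≥ λ 1+i<a → <-irrefl refl (≤-trans
    (≤-trans (≤-reflexive (double i)) (*-monoʳ-≤ 2 1+i<a)) h)
    where
    double : ∀ i → suc (1 + 2 * suc i) ≡ 2 * suc (suc i)
    double = solve-∀
  rearrange : ∀ x u h → x * u * h ≡ u * (x * h)
  rearrange = solve-∀
  3^e∣ : 3 ^ e ∣ 3 ^ a * h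
  3^e∣ = p^e∣u*n⇒p^e∣n 3-prime e 3∤u (subst (3 ^ e ∣_)
    (trans (cong (_* h) N!≡) (rearrange (3 ^ a) u h)) d)
  regroup : ∀ x h → 3 * x * (3 * x) * h ≡ 3 * (x * (3 * x * h))
  regroup = solve-∀
  9^≡ : 9 ^ suc i * h ≡ 3 * (3 ^ i * (3 ^ suc i * h))
  9^≡ = trans (cong (_* h) (trans (^-*-assoc 3 2 (suc i))
                (trans (cong (3 ^_) (2*n (suc i))) (^-distribˡ-+-* 3 (suc i) (suc i)))))
              (regroup (3 ^ i) h)
    where
    2*n : ∀ n → 2 * n ≡ n + n
    2*n = solve-∀

-- Delannoy and Schröder numbers

delannoy : ℕ → ℕ → ℕ
delannoy zero    _       = 1
delannoy (suc x) zero    = 1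
delannoy (suc x) (suc y) = delannoy x (suc y) + delannoy (suc x) y + delannoy x y

delannoy-0 : ∀ x → delannoy x 0 ≡ 1
delannoy-0 zero    = refl
delannoy-0 (suc x) = refl

delannoy-comm : ∀ x y → delannoy x y ≡ delannoy y x
delannoy-comm zero    zero    = refl
delannoy-comm zero    (suc y) = refl
delannoy-comm (suc x) zero    = refl
delannoy-comm (suc x) (suc y) = cong₂ _+_
  (trans (cong₂ _+_ (delannoy-comm x (suc y)) (delannoy-comm (suc x) y)) (+-comm (delannoy (suc y) x) _))
  (delannoy-comm x y)

delannoy-1 : ∀ y → delannoy 1 y ≡ suc (2 * y)
delannoy-1 zero    = refl
delannoy-1 (suc y) = trans (cong (λ d → 1 + d + 1) (delannoy-1 y)) (lemma y)
  where
  lemma : ∀ y → 1 + suc (2 * y) + 1 ≡ suc (2 * suc y)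
  lemma = solve-∀

-- The generating function 1/(1-s-t-st) is annihilated by (1+s)∂ₛ - (1+t)∂ₜ.
delannoy-contiguous : ∀ x y →
  suc x * delannoy (suc x) y + x * delannoy x y ≡ suc y * delannoy x (suc y) + y * delannoy x y
delannoy-contiguous zero y = trans (cong (λ d → 1 * d + 0) (delannoy-1 y)) (lemma y)
  where
  lemma : ∀ y → 1 * suc (2 * y) + 0 ≡ suc y * 1 + y * 1
  lemma = solve-∀
delannoy-contiguous (suc x) zero = trans (lemma x)
  (cong (λ d → 1 * d + 0) (sym (trans (delannoy-comm (suc x) 1) (delannoy-1 (suc x)))))
  where
  lemma : ∀ x → suc (suc x) * 1 + suc x * 1 ≡ 1 * suc (2 * suc x) + 0
  lemma = solve-∀
delannoy-contiguous (suc x) (suc y) = begin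
    suc (suc x) * (d₁₁ + d₂₀ + d₁₀) + suc x * d₁₁  ≡⟨ left x d₀₁ d₁₀ d₀₀ d₂₀ d₁₁ refl ⟩
    -- The three groups are the left sides of the identity at (x, y+1), (x+1, y) and (x, y). Once
    -- d₁₁ is expanded by its own recurrence, both sides leave over the same 2 * d₁₁.
    (suc x * d₁₁ + x * d₀₁) + (suc (suc x) * d₂₀ + suc x * d₁₀) + (suc x * d₁₀ + x * d₀₀) + 2 * d₁₁
      ≡⟨ cong (_+ 2 * d₁₁) (cong₂ _+_
           (cong₂ _+_ (delannoy-contiguous x (suc y)) (delannoy-contiguous (suc x) y)) (delannoy-contiguous x y)) ⟩
    (suc (suc y) * d₀₂ + suc y * d₀₁) + (suc y * d₁₁ + y * d₁₀) + (suc y * d₀₁ + y * d₀₀) + 2 * d₁₁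
      ≡⟨ right y d₀₁ d₁₀ d₀₀ d₀₂ d₁₁ refl ⟩
    suc (suc y) * (d₀₂ + d₁₁ + d₀₁) + suc y * d₁₁ ∎
  where
  open ≡-Reasoning
  d₂₀ = delannoy (suc (suc x)) y
  d₁₀ = delannoy (suc x) y
  d₁₁ = delannoy (suc x) (suc y)
  d₀₂ = delannoy x (suc (suc y))
  d₀₁ = delannoy x (suc y)
  d₀₀ = delannoy x y
  left : ∀ x f b g a c → c ≡ f + b + g →
    suc (suc x) * (c + a + b) + suc x * c ≡
    (suc x * c + x * f) + (suc (suc x) * a + suc x * b) + (suc x * b + x * g) + 2 * c
  left x f b g a _ refl = ring x f b g a
    where
    ring : ∀ x f b g a → suc (suc x) * ((f + b + g) + a + b) + suc x * (f + b + g) ≡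
      (suc x * (f + b + g) + x * f) + (suc (suc x) * a + suc x * b) + (suc x * b + x * g) + 2 * (f + b + g)
    ring = solve-∀
  right : ∀ y f b g e c → c ≡ f + b + g →
    (suc (suc y) * e + suc y * f) + (suc y * c + y * b) + (suc y * f + y * g) + 2 * c ≡
    suc (suc y) * (e + c + f) + suc y * c
  right y f b g e _ refl = ring y f b g e
    where
    ring : ∀ y f b g e → (suc (suc y) * e + suc y * f) + (suc y * (f + b + g) + y * b) + (suc y * f + y * g) + 2 * (f + b + g) ≡
      suc (suc y) * (e + (f + b + g) + f) + suc y * (f + b + g)
    ring = solve-∀

-- Schröder paths and the reflection principle

length-paths-suc : ∀ x y → length (paths (suc x) (suc y)) ≡
  length (paths x (suc y)) + (length (map-north (suc y ≤? suc x) (paths (suc x) y)) + length (paths x y))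
length-paths-suc x y = trans (length-++ (map east (paths x (suc y)))) (cong₂ _+_ (length-map east (paths x (suc y)))
  (trans (length-++ (map-north (suc y ≤? suc x) (paths (suc x) y)))
    (cong (λ l → length (map-north (suc y ≤? suc x) (paths (suc x) y)) + l) (length-map diag (paths x y)))))

length-map-north : ∀ {x y} (d : Dec (suc y ≤ x)) ps → suc y ≤ x → length (map-north d ps) ≡ length ps
length-map-north (yes q) ps _  = length-map (north q) ps
length-map-north (no ¬q) ps q = contradiction q ¬q

length-map-north-no : ∀ {x y} (d : Dec (suc y ≤ x)) ps → x ≤ y → length (map-north d ps) ≡ 0
length-map-north-no (yes q) ps x≤y = contradiction q (≤⇒≯ x≤y)
length-map-north-no (no  _) ps _   = refl

paths-above : ∀ {x y} → x < y → length (paths x y) ≡ 0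
paths-above {zero}  {suc y} _         = refl
paths-above {suc x} {suc y} (s≤s x<y) = trans (length-paths-suc x y)
  (cong₂ _+_ (paths-above (m≤n⇒m≤1+n x<y))
             (cong₂ _+_ (length-map-north-no (suc y ≤? suc x) (paths (suc x) y) x<y) (paths-above x<y)))

paths-0 : ∀ x → length (paths x 0) ≡ 1
paths-0 zero    = refl
paths-0 (suc x) = trans (length-map east (paths x 0)) (paths-0 x)

-- Reflecting in y = x + 1 the paths from (0,0) to (x,y+1) that meet this line
-- gives the unrestricted paths to (y,x+1), of which there are as many as to (x+1,y).
reflection : ∀ x y → y ≤ x → length (paths x (suc y)) + delannoy (suc x) y ≡ delannoy x (suc y)
reflection zero    zero    _ = refl
reflection (suc x) y y≤1+x with m≤n⇒m<n∨m≡n y≤1+x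
-- On the boundary y = x + 1 no admissible path is left, and the claim is the symmetry of
-- `delannoy`. Away from it both sides obey the same three-term recurrence.
... | inj₂ refl = trans (cong (_+ delannoy (suc (suc x)) (suc x)) (paths-above {suc x} {suc (suc x)} ≤-refl))
                        (delannoy-comm (suc (suc x)) (suc x))
reflection (suc x) zero    _ | inj₁ _ = trans
  (cong (_+ 1) (trans (length-paths-suc x 0) (cong (λ l → length (paths x 1) + l)
     (cong₂ _+_ (trans (length-map-north (1 ≤? suc x) (paths (suc x) 0) (s≤s z≤n)) (paths-0 (suc x))) (paths-0 x)))))
  (trans (lemma (length (paths x 1))) (cong₂ (λ a b → a + 1 + b) (reflection x 0 z≤n) (sym (delannoy-0 x))))
  where
  lemma : ∀ a → a + (1 + 1) + 1 ≡ (a + 1) + 1 + 1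
  lemma = solve-∀
reflection (suc x) (suc y) 1+y≤1+x | inj₁ (s≤s 1+y≤x) = trans
  (cong (_+ delannoy (suc (suc x)) (suc y)) (trans (length-paths-suc x (suc y)) (cong (λ l → length (paths x (suc (suc y))) + l)
     (cong (_+ length (paths x (suc y))) (length-map-north (suc (suc y) ≤? suc x) (paths (suc x) (suc y)) (s≤s 1+y≤x))))))
  (trans (lemma (length (paths x (suc (suc y)))) (length (paths (suc x) (suc y))) (length (paths x (suc y))) (delannoy (suc x) (suc y)) _ _)
    (cong₂ _+_ (cong₂ _+_ (reflection x (suc y) 1+y≤x) (reflection (suc x) y (≤-trans (n≤1+n y) 1+y≤1+x)))
               (reflection x y (≤-trans (n≤1+n y) 1+y≤x))))
  where
  lemma : ∀ a b c d e f → a + (b + c) + (d + e + f) ≡ (a + d) + (b + e) + (c + f)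
  lemma = solve-∀

-- Two diagonals suffice: `central-suc` and `near-suc` advance the pair by a first-order linear
-- system, and `[2+n]*S` and `n*S` express S linearly in it. Eliminating the pair leaves a
-- recurrence for S alone.
central near : ℕ → ℕ
central n = delannoy n n
near    n = delannoy (suc n) n

central-suc : ∀ n → central (suc n) ≡ central n + 2 * near n
central-suc n = trans (cong (λ d → d + near n + central n) (delannoy-comm n (suc n))) (lemma (near n) (central n))
  where
  lemma : ∀ p c → p + p + c ≡ c + 2 * p
  lemma = solve-∀

-- Contiguity at (n+1, n) removes the next diagonal: `near n` occurs n + 1 times on one side and n
-- times on the other.
far-eq : ∀ n → (2 + n) * delannoy (2 + n) n + near n ≡ (1 + n) * central (1 + n)
far-eq n = +-cancelʳ-≡ (n * near n) _ _ (trans (lemma n (delannoy (2 + n) n) (near n)) (delannoy-contiguous (suc n) n))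
  where
  lemma : ∀ n q p → (2 + n) * q + p + n * p ≡ (2 + n) * q + (1 + n) * p
  lemma = solve-∀

near-suc : ∀ n → (2 + n) * near (1 + n) ≡ (3 + 2 * n) * central (1 + n) + (1 + n) * near n
near-suc n = +-cancelʳ-≡ (near n) _ _ (trans (left n (central (1 + n)) _ (near n))
  (trans (cong (λ z → (2 + n) * central (1 + n) + z + (2 + n) * near n) (far-eq n)) (right n (central (1 + n)) (near n))))
  where
  left : ∀ n c q p → (2 + n) * (c + q + p) + p ≡ (2 + n) * c + ((2 + n) * q + p) + (2 + n) * p
  left = solve-∀
  right : ∀ n c p → (2 + n) * c + (1 + n) * c + (2 + n) * p ≡ (3 + 2 * n) * c + (1 + n) * p + p
  right = solve-∀

S-central : ∀ n → S (suc n) + delannoy (2 + n) n ≡ central (1 + n)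
S-central n = reflection (suc n) n (n≤1+n n)

[2+n]*S : ∀ n → (2 + n) * S (1 + n) ≡ central (1 + n) + near n
[2+n]*S n = +-cancelʳ-≡ ((2 + n) * delannoy (2 + n) n) _ _
  (trans (sym (*-distribˡ-+ (2 + n) (S (1 + n)) _))
  (trans (cong ((2 + n) *_) (S-central n))
  (trans (lemma n (central (1 + n)))
  (trans (cong (λ z → central (1 + n) + z) (sym (far-eq n))) (swap (central (1 + n)) _ (near n))))))
  where
  lemma : ∀ n c → (2 + n) * c ≡ c + (1 + n) * c
  lemma = solve-∀
  swap : ∀ c q p → c + (q + p) ≡ c + p + q
  swap = solve-∀

n*S : ∀ n → (1 + n) * S (1 + n) + central (1 + n) ≡ near (1 + n)
n*S n = *-cancelˡ-≡ _ _ (2 + n) (trans (left n (S (1 + n)) c)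
  (trans (cong (λ z → (1 + n) * z + (2 + n) * c) ([2+n]*S n))
  (trans (right n c (near n)) (sym (near-suc n)))))
  where
  c = central (1 + n)
  left : ∀ n s c → (2 + n) * ((1 + n) * s + c) ≡ (1 + n) * ((2 + n) * s) + (2 + n) * c
  left = solve-∀
  right : ∀ n c p → (1 + n) * (c + p) + (2 + n) * c ≡ (3 + 2 * n) * c + (1 + n) * p
  right = solve-∀

S-recurrence : ∀ n → (4 + n) * S (3 + n) + (1 + n) * S (1 + n) ≡ 3 * (5 + 2 * n) * S (2 + n)
-- The factor 3 + n makes `[2+n]*S` and `near-suc` applicable. The summand (3 + n) * c replaces a
-- subtraction, since `n*S` gives (1 + n) * S (1 + n) as p minus c.
S-recurrence n = *-cancelˡ-≡ _ _ (3 + n) (+-cancelʳ-≡ ((3 + n) * c) _ _ (begin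
  (3 + n) * ((4 + n) * S (3 + n) + (1 + n) * S (1 + n)) + (3 + n) * c
    ≡⟨ r₁ n ((4 + n) * S (3 + n)) ((1 + n) * S (1 + n)) c ⟩
  (3 + n) * ((4 + n) * S (3 + n)) + (3 + n) * ((1 + n) * S (1 + n) + c)
    ≡⟨ cong₂ (λ u v → (3 + n) * u + (3 + n) * v)
         (trans ([2+n]*S (2 + n)) (cong (_+ p₂) (central-suc (2 + n)))) (n*S n) ⟩
  (3 + n) * ((c₂ + 2 * p₂) + p₂) + (3 + n) * p
    ≡⟨ r₂ n c₂ p₂ p ⟩
  (3 + n) * c₂ + 3 * ((3 + n) * p₂) + (3 + n) * p
    ≡⟨ cong₂ (λ u v → (3 + n) * u + 3 * v + (3 + n) * p) (central-suc (1 + n)) (near-suc (1 + n)) ⟩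
  (3 + n) * (c + 2 * p) + 3 * ((3 + 2 * (1 + n)) * c₂ + (2 + n) * p) + (3 + n) * p
    ≡⟨ cong (λ u → (3 + n) * (c + 2 * p) + 3 * ((3 + 2 * (1 + n)) * u + (2 + n) * p) + (3 + n) * p) (central-suc (1 + n)) ⟩
  (3 + n) * (c + 2 * p) + 3 * ((3 + 2 * (1 + n)) * (c + 2 * p) + (2 + n) * p) + (3 + n) * p
    ≡⟨ r₃ n c p ⟩
  3 * (5 + 2 * n) * ((c + 2 * p) + p) + (3 + n) * c
    ≡⟨ cong (λ u → 3 * (5 + 2 * n) * (u + p) + (3 + n) * c) (central-suc (1 + n)) ⟨
  3 * (5 + 2 * n) * (c₂ + p) + (3 + n) * c
    ≡⟨ cong (λ u → 3 * (5 + 2 * n) * u + (3 + n) * c) ([2+n]*S (1 + n)) ⟨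
  3 * (5 + 2 * n) * ((3 + n) * S (2 + n)) + (3 + n) * c
    ≡⟨ r₄ n (S (2 + n)) c ⟩
  (3 + n) * (3 * (5 + 2 * n) * S (2 + n)) + (3 + n) * c ∎))
  where
  open ≡-Reasoning
  c  = central (1 + n)
  p  = near (1 + n)
  c₂ = central (2 + n)
  p₂ = near (2 + n)
  r₁ : ∀ n u v c → (3 + n) * (u + v) + (3 + n) * c ≡ (3 + n) * u + (3 + n) * (v + c)
  r₁ = solve-∀
  r₂ : ∀ n c₂ p₂ p → (3 + n) * ((c₂ + 2 * p₂) + p₂) + (3 + n) * p ≡ (3 + n) * c₂ + 3 * ((3 + n) * p₂) + (3 + n) * p
  r₂ = solve-∀
  r₃ : ∀ n c p → (3 + n) * (c + 2 * p) + 3 * ((3 + 2 * (1 + n)) * (c + 2 * p) + (2 + n) * p) + (3 + n) * p ≡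
    3 * (5 + 2 * n) * ((c + 2 * p) + p) + (3 + n) * c
  r₃ = solve-∀
  r₄ : ∀ n s c → 3 * (5 + 2 * n) * ((3 + n) * s) + (3 + n) * c ≡ (3 + n) * (3 * (5 + 2 * n) * s) + (3 + n) * c
  r₄ = solve-∀

-- The explicit formula

C-absorb : ∀ n k → suc k * (suc n C suc k) ≡ suc n * (n C k)
C-absorb zero    zero    = refl
C-absorb zero    (suc k) = *-zeroʳ (2 + k)
C-absorb (suc n) k       = trans (cong (suc k *_) (sym (nCk+nC[k+1]≡[n+1]C[k+1] (suc n) k))) (go k)
  where
  go : ∀ k → suc k * (suc n C k + suc n C suc k) ≡ (2 + n) * (suc n C k)
  go zero    = trans (lemma₀ (suc n C 1)) (trans (cong suc (C-absorb n 0)) (lemma₁ n))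
    where
    lemma₀ : ∀ c → 1 * (1 + c) ≡ 1 + 1 * c
    lemma₀ = solve-∀
    lemma₁ : ∀ n → 1 + (1 + n) * 1 ≡ (2 + n) * 1
    lemma₁ = solve-∀
  go (suc k) = trans (lemma k a b) (trans (cong₂ (λ u v → a + u + v) (C-absorb n k) (C-absorb n (suc k)))
    (trans (lemma₂ n a (n C k) (n C suc k)) (cong (λ c → a + suc n * c) (nCk+nC[k+1]≡[n+1]C[k+1] n k))))
    where
    a = suc n C suc k
    b = suc n C suc (suc k)
    lemma : ∀ k a b → (2 + k) * (a + b) ≡ a + (1 + k) * a + (2 + k) * b
    lemma = solve-∀
    lemma₂ : ∀ n a x y → a + (1 + n) * x + (1 + n) * y ≡ a + (1 + n) * (x + y)
    lemma₂ = solve-∀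

-- Subtraction-free form of (n+1-k) C(n+1,k) = (n+1) C(n,k), valid for all k.
C-absorb′ : ∀ n k → suc n * (n C k) + k * (suc n C k) ≡ suc n * (suc n C k)
C-absorb′ n zero    = +-identityʳ _
C-absorb′ n (suc k) = trans (cong (λ z → suc n * (n C suc k) + z) (C-absorb n k))
  (trans (lemma n (n C suc k) (n C k)) (cong (suc n *_) (nCk+nC[k+1]≡[n+1]C[k+1] n k)))
  where
  lemma : ∀ n x y → (1 + n) * x + (1 + n) * y ≡ (1 + n) * (y + x)
  lemma = solve-∀

C-sym-middle : ∀ n → suc n * (suc (2 * n) C n) ≡ suc (2 * n) * (2 * n C n)
C-sym-middle n = +-cancelʳ-≡ (n * (suc (2 * n) C n)) _ _
  (trans (lemma n (suc (2 * n) C n)) (sym (C-absorb′ (2 * n) n)))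
  where
  lemma : ∀ n c → (1 + n) * c + n * c ≡ (1 + 2 * n) * c
  lemma = solve-∀

catalan-suc : ∀ n → (2 + n) * catalan (suc n) ≡ 2 * (1 + 2 * n) * catalan n
catalan-suc n = *-cancelˡ-≡ _ _ ((1 + n) * (1 + n)) (begin
  (1 + n) * (1 + n) * ((2 + n) * catalan (suc n))  ≡⟨ cong ((1 + n) * (1 + n) *_) (suc*catalan (suc n)) ⟩
  (1 + n) * (1 + n) * (2 * suc n C suc n)          ≡⟨ cong (λ m → (1 + n) * (1 + n) * (m C suc n)) (double n) ⟩
  (1 + n) * (1 + n) * (suc (1 + 2 * n) C suc n)    ≡⟨ *-assoc (1 + n) (1 + n) _ ⟩
  (1 + n) * ((1 + n) * (suc (1 + 2 * n) C suc n))  ≡⟨ cong ((1 + n) *_) (C-absorb (1 + 2 * n) n) ⟩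
  (1 + n) * ((2 + 2 * n) * (suc (2 * n) C n))      ≡⟨ swap n (suc (2 * n) C n) ⟩
  (2 + 2 * n) * ((1 + n) * (suc (2 * n) C n))      ≡⟨ cong ((2 + 2 * n) *_) (C-sym-middle n) ⟩
  (2 + 2 * n) * ((1 + 2 * n) * (2 * n C n))        ≡⟨ cong (λ z → (2 + 2 * n) * ((1 + 2 * n) * z)) (suc*catalan n) ⟨
  (2 + 2 * n) * ((1 + 2 * n) * ((1 + n) * catalan n)) ≡⟨ final n (catalan n) ⟩
  (1 + n) * (1 + n) * (2 * (1 + 2 * n) * catalan n) ∎)
  where
  open ≡-Reasoning
  double : ∀ n → 2 * (1 + n) ≡ 2 + 2 * n
  double = solve-∀
  swap : ∀ n c → (1 + n) * ((2 + 2 * n) * c) ≡ (2 + 2 * n) * ((1 + n) * c)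
  swap = solve-∀
  final : ∀ n c → (2 + 2 * n) * ((1 + 2 * n) * ((1 + n) * c)) ≡ (1 + n) * (1 + n) * (2 * (1 + 2 * n) * c)
  final = solve-∀

-- (2m)! / (m! k! (m+1-k)!), the coefficient of s^k t^(m+1-k) in (1 - √(1-4(s+t)))/2.
G : ℕ → ℕ → ℕ
G m k = catalan m * (suc m C k)

G-suc-suc : ∀ m k → suc k * G (suc m) (suc k) ≡ 2 * (1 + 2 * m) * G m k
G-suc-suc m k = begin
  suc k * (catalan (suc m) * (suc (suc m) C suc k))  ≡⟨ swap k (catalan (suc m)) _ ⟩
  catalan (suc m) * (suc k * (suc (suc m) C suc k))  ≡⟨ cong (catalan (suc m) *_) (C-absorb (suc m) k) ⟩
  catalan (suc m) * ((2 + m) * (suc m C k))          ≡⟨ regroup m (catalan (suc m)) _ ⟩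
  (2 + m) * catalan (suc m) * (suc m C k)            ≡⟨ cong (_* (suc m C k)) (catalan-suc m) ⟩
  2 * (1 + 2 * m) * catalan m * (suc m C k)          ≡⟨ *-assoc (2 * (1 + 2 * m)) (catalan m) _ ⟩
  2 * (1 + 2 * m) * G m k                            ∎
  where
  open ≡-Reasoning
  swap : ∀ k b c → (1 + k) * (b * c) ≡ b * ((1 + k) * c)
  swap = solve-∀
  regroup : ∀ m b c → b * ((2 + m) * c) ≡ (2 + m) * b * c
  regroup = solve-∀

-- Subtraction-free form of (m+2-k) G(m+1,k) = 2(1+2m) G(m,k). It raises the exponent of t, as
-- `G-suc-suc` raises that of s.
G-suc : ∀ m k → 2 * (1 + 2 * m) * G m k + k * G (suc m) k ≡ (2 + m) * G (suc m) k
G-suc m k = begin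
  2 * (1 + 2 * m) * G m k + k * G (suc m) k
    ≡⟨ cong (_+ k * G (suc m) k) (*-assoc (2 * (1 + 2 * m)) (catalan m) _) ⟨
  2 * (1 + 2 * m) * catalan m * (suc m C k) + k * G (suc m) k
    ≡⟨ cong (λ z → z * (suc m C k) + k * G (suc m) k) (catalan-suc m) ⟨
  (2 + m) * catalan (suc m) * (suc m C k) + k * (catalan (suc m) * (suc (suc m) C k))
    ≡⟨ factor m k (catalan (suc m)) (suc m C k) (suc (suc m) C k) ⟩
  catalan (suc m) * ((2 + m) * (suc m C k) + k * (suc (suc m) C k))
    ≡⟨ cong (catalan (suc m) *_) (C-absorb′ (suc m) k) ⟩
  catalan (suc m) * ((2 + m) * (suc (suc m) C k))
    ≡⟨ swap m (catalan (suc m)) _ ⟩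
  (2 + m) * G (suc m) k ∎
  where
  open ≡-Reasoning
  factor : ∀ m k c x y → (2 + m) * c * x + k * (c * y) ≡ c * ((2 + m) * x + k * y)
  factor = solve-∀
  swap : ∀ m c x → c * ((2 + m) * x) ≡ (2 + m) * (c * x)
  swap = solve-∀

-- The coefficient of 3^(k+1) in the recurrence for 2^(N+1) S_N, where N = M+2.
G-recurrence : ∀ m k M → 2 * m ≡ M + k →
  (3 + M) * G (suc m) (suc k) ≡ 2 * (3 + 2 * M) * G m k + 4 * M * G m (suc k)
-- Both neighbours become multiples of X: 2(1+2m)Y = (k+1)X and 2(1+2m)Z = (m+1-k)X. What remains is
-- a polynomial identity under 2m = M + k; the added 2M(k+1)X absorbs the subtraction in m+1-k.
G-recurrence m k M 2m≡M+k = *-cancelˡ-≡ _ _ (1 + 2 * m) (+-cancelʳ-≡ (2 * M * (suc k * X)) _ _ (begin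
  (1 + 2 * m) * ((3 + M) * X) + 2 * M * (suc k * X)
    ≡⟨ cong (λ s → (1 + s) * ((3 + M) * X) + 2 * M * (suc k * X)) 2m≡M+k ⟩
  (1 + (M + k)) * ((3 + M) * X) + 2 * M * (suc k * X)
    ≡⟨ collect M k X ⟩
  (3 + 2 * M) * (suc k * X) + M * (4 + (M + k)) * X
    ≡⟨ cong (λ s → (3 + 2 * M) * (suc k * X) + M * (4 + s) * X) 2m≡M+k ⟨
  (3 + 2 * M) * (suc k * X) + M * (4 + 2 * m) * X
    ≡⟨ halve m ((3 + 2 * M) * (suc k * X)) M X ⟩
  (3 + 2 * M) * (suc k * X) + 2 * M * ((2 + m) * X)
    ≡⟨ cong₂ (λ u v → (3 + 2 * M) * u + 2 * M * v) (G-suc-suc m k) (sym (G-suc m (suc k))) ⟩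
  (3 + 2 * M) * (2 * (1 + 2 * m) * Y) + 2 * M * (2 * (1 + 2 * m) * Z + suc k * X)
    ≡⟨ factor m M Y Z (suc k * X) ⟩
  (1 + 2 * m) * (2 * (3 + 2 * M) * Y + 4 * M * Z) + 2 * M * (suc k * X) ∎))
  where
  open ≡-Reasoning
  X = G (suc m) (suc k)
  Y = G m k
  Z = G m (suc k)
  collect : ∀ M k X → (1 + (M + k)) * ((3 + M) * X) + 2 * M * ((1 + k) * X) ≡
    (3 + 2 * M) * ((1 + k) * X) + M * (4 + (M + k)) * X
  collect = solve-∀
  halve : ∀ m W M X → W + M * (4 + 2 * m) * X ≡ W + 2 * M * ((2 + m) * X)
  halve = solve-∀
  factor : ∀ m M Y Z W → (3 + 2 * M) * (2 * (1 + 2 * m) * Y) + 2 * M * (2 * (1 + 2 * m) * Z + W) ≡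
    (1 + 2 * m) * (2 * (3 + 2 * M) * Y + 4 * M * Z) + 2 * M * W
  factor = solve-∀

-- With f = √(1-6x+x²), (1-f)/2 = x/2 + x·ΣS_N x^N expands in s = 3x/2 and t = -x²/4 to
--   2^(N+1) S_N = Σ_{k+2j=N+1} (-1)^j 3^k G(j+k-1,k).
-- The odd term is |summand| for N = 2n+1, k = 2i; the even one is a third of it for
-- N = 2n+2, k = 2i+1.
oddTerm evenTerm : ℕ → ℕ → ℕ
oddTerm  n i = 9 ^ i * G (n + i) (2 * i)
evenTerm n i = 9 ^ i * G (1 + n + i) (1 + 2 * i)

oddTerm-0 : ∀ n → oddTerm n 0 ≡ catalan n
oddTerm-0 n = trans (*-identityˡ _) (trans (*-identityʳ _) (cong catalan (+-identityʳ n)))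

-- The power 3^0 is outside `G-recurrence`: no even term contributes to it, and the relation is the
-- ratio of consecutive Catalan numbers.
oddTerm-suc-0 : ∀ n → (4 + 2 * n) * oddTerm (suc n) 0 ≡ 4 * (1 + 2 * n) * oddTerm n 0
oddTerm-suc-0 n = trans (cong ((4 + 2 * n) *_) (oddTerm-0 (suc n))) (trans (left n (catalan (suc n)))
  (trans (cong (2 *_) (catalan-suc n)) (trans (right n (catalan n)) (cong (4 * (1 + 2 * n) *_) (sym (oddTerm-0 n))))))
  where
  left : ∀ n c → (4 + 2 * n) * c ≡ 2 * ((2 + n) * c)
  left = solve-∀
  right : ∀ n c → 2 * (2 * (1 + 2 * n) * c) ≡ 4 * (1 + 2 * n) * c
  right = solve-∀

2*suc : ∀ i → 2 * suc i ≡ 2 + 2 * i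
2*suc = solve-∀

-- In 18 = 2 * 3 * 3 one 3 belongs to the recurrence of S and one makes up for `evenTerm` being a
-- third of its summand. In `evenTerm-suc` that third cancels the 3 and leaves 2.
oddTerm-suc-suc : ∀ n i →
  (4 + 2 * n) * oddTerm (suc n) (suc i) ≡ 18 * (5 + 4 * n) * evenTerm n i + 4 * (1 + 2 * n) * oddTerm n (suc i)
oddTerm-suc-suc n i = begin
  (4 + 2 * n) * (9 * x * G (suc n + suc i) (2 * suc i))
    ≡⟨ cong₂ (λ m k → (4 + 2 * n) * (9 * x * G m k)) (cong suc (+-suc n i)) (2*suc i) ⟩
  (4 + 2 * n) * (9 * x * G (2 + n + i) (2 + 2 * i))
    ≡⟨ left n x _ ⟩
  9 * x * ((3 + (1 + 2 * n)) * G (2 + n + i) (2 + 2 * i))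
    ≡⟨ cong (9 * x *_) (G-recurrence (1 + n + i) (1 + 2 * i) (1 + 2 * n) (index n i)) ⟩
  9 * x * (2 * (3 + 2 * (1 + 2 * n)) * G (1 + n + i) (1 + 2 * i) + 4 * (1 + 2 * n) * G (1 + n + i) (2 + 2 * i))
    ≡⟨ right n x (G (1 + n + i) (1 + 2 * i)) (G (1 + n + i) (2 + 2 * i)) ⟩
  18 * (5 + 4 * n) * evenTerm n i + 4 * (1 + 2 * n) * (9 * x * G (1 + n + i) (2 + 2 * i))
    ≡⟨ cong₂ (λ m k → 18 * (5 + 4 * n) * evenTerm n i + 4 * (1 + 2 * n) * (9 * x * G m k))
             (+-suc n i) (2*suc i) ⟨
  18 * (5 + 4 * n) * evenTerm n i + 4 * (1 + 2 * n) * oddTerm n (suc i) ∎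
  where
  open ≡-Reasoning
  x = 9 ^ i
  index : ∀ n i → 2 * (1 + n + i) ≡ (1 + 2 * n) + (1 + 2 * i)
  index = solve-∀
  left : ∀ n x g → (4 + 2 * n) * (9 * x * g) ≡ 9 * x * ((3 + (1 + 2 * n)) * g)
  left = solve-∀
  right : ∀ n x g h → 9 * x * (2 * (3 + 2 * (1 + 2 * n)) * g + 4 * (1 + 2 * n) * h) ≡
    18 * (5 + 4 * n) * (x * g) + 4 * (1 + 2 * n) * (9 * x * h)
  right = solve-∀

evenTerm-suc : ∀ n i →
  (5 + 2 * n) * evenTerm (suc n) i ≡ 2 * (7 + 4 * n) * oddTerm (suc n) i + 4 * (2 + 2 * n) * evenTerm n i
evenTerm-suc n i = trans (left n (9 ^ i) _) (trans
  (cong (9 ^ i *_) (G-recurrence (1 + n + i) (2 * i) (2 + 2 * n) (index n i)))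
  (right n (9 ^ i) (G (1 + n + i) (2 * i)) (G (1 + n + i) (1 + 2 * i))))
  where
  index : ∀ n i → 2 * (1 + n + i) ≡ (2 + 2 * n) + 2 * i
  index = solve-∀
  left : ∀ n x g → (5 + 2 * n) * (x * g) ≡ x * ((3 + (2 + 2 * n)) * g)
  left = solve-∀
  right : ∀ n x g h → x * (2 * (3 + 2 * (2 + 2 * n)) * g + 4 * (2 + 2 * n) * h) ≡
    2 * (7 + 4 * n) * (x * g) + 4 * (2 + 2 * n) * (x * h)
  right = solve-∀

-- Alternating sums of the terms

G-vanishes : ∀ {m k} → suc m < k → G m k ≡ 0
G-vanishes {m} m<k = trans (cong (catalan m *_) (k>n⇒nCk≡0 m<k)) (*-zeroʳ (catalan m))

oddTerm-vanishes : ∀ n → oddTerm n (2 + n) ≡ 0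
oddTerm-vanishes n = trans (cong (9 ^ (2 + n) *_) (G-vanishes (≤-reflexive (lemma n)))) (*-zeroʳ (9 ^ (2 + n)))
  where
  lemma : ∀ n → 2 + (n + (2 + n)) ≡ 2 * (2 + n)
  lemma = solve-∀

evenTerm-vanishes : ∀ n → evenTerm n (2 + n) ≡ 0
evenTerm-vanishes n = trans (cong (9 ^ (2 + n) *_) (G-vanishes (≤-reflexive (lemma n)))) (*-zeroʳ (9 ^ (2 + n)))
  where
  lemma : ∀ n → 2 + (1 + n + (2 + n)) ≡ 1 + 2 * (2 + n)
  lemma = solve-∀

-- Subtracting the tail produces the signs and has, by definition, the shape that `∥-subtract`
-- expects.
alternatingSum : ℕ → (ℕ → ℕ) → ℤ
alternatingSum zero    f = + 0
alternatingSum (suc M) f = + f 0 - alternatingSum M (f ∘ suc)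

alternatingSum-last : ∀ M f → f M ≡ 0 → alternatingSum (suc M) f ≡ alternatingSum M f
alternatingSum-last zero    f f0≡0 = cong (λ x → + x - + 0) f0≡0
alternatingSum-last (suc M) f fM≡0 = cong (λ z → + f 0 - z) (alternatingSum-last M (f ∘ suc) fM≡0)

∣-alternatingSum : ∀ M {d} f → (∀ i → d ∣ f i) → + d Signed.∣ alternatingSum M f
∣-alternatingSum zero    f d∣f = Signed.divides (+ 0) refl
∣-alternatingSum (suc M) f d∣f =
  Signed.∣m∣n⇒∣m-n {m = + f 0} (Signed.∣ᵤ⇒∣ (d∣f 0)) (∣-alternatingSum M (f ∘ suc) (d∣f ∘ suc))

pos-linear₂ : ∀ a b c x y z → a * x ≡ b * y + c * z → + a ℤ.* + x ≡ + b ℤ.* + y ℤ.+ + c ℤ.* + z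
pos-linear₂ a b c x y z eq = trans (sym (ℤ.pos-* a x)) (trans (cong +_ eq)
  (trans (ℤ.pos-+ (b * y) (c * z)) (cong₂ ℤ._+_ (ℤ.pos-* b y) (ℤ.pos-* c z))))

alternatingSum-linear : ∀ a b c M f g h → (∀ i → a * f i ≡ b * g i + c * h i) →
  + a ℤ.* alternatingSum M f ≡ + b ℤ.* alternatingSum M g ℤ.+ + c ℤ.* alternatingSum M h
alternatingSum-linear a b c zero f g h eq = lemma (+ a) (+ b) (+ c)
  where
  lemma : ∀ a b c → a ℤ.* + 0 ≡ b ℤ.* + 0 ℤ.+ c ℤ.* + 0
  lemma = ℤSolver.solve-∀
alternatingSum-linear a b c (suc M) f g h eq =
  trans (left (+ a) (+ f 0) (alternatingSum M (f ∘ suc)))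
  (trans (cong₂ _-_ (pos-linear₂ a b c (f 0) (g 0) (h 0) (eq 0)) (alternatingSum-linear a b c M (f ∘ suc) (g ∘ suc) (h ∘ suc) (eq ∘ suc)))
         (right (+ b) (+ c) (+ g 0) (+ h 0) (alternatingSum M (g ∘ suc)) (alternatingSum M (h ∘ suc))))
  where
  left : ∀ a x y → a ℤ.* (x - y) ≡ a ℤ.* x - a ℤ.* y
  left = ℤSolver.solve-∀
  right : ∀ b c x y u v → (b ℤ.* x ℤ.+ c ℤ.* y) - (b ℤ.* u ℤ.+ c ℤ.* v) ≡ b ℤ.* (x - u) ℤ.+ c ℤ.* (y - v)
  right = ℤSolver.solve-∀

-- The nonzero terms are exactly those with i ≤ n + 1. Sums for consecutive n differ in length by
-- one, which the vanishing term at 2 + n bridges.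
oddSum evenSum : ℕ → ℤ
oddSum  n = alternatingSum (2 + n) (oddTerm n)
evenSum n = alternatingSum (2 + n) (evenTerm n)

-- Odd terms at i + 1 meet even terms at i, and this shift flips the sign. Hence `evenSum n` stands
-- on the left here but on the right in `evenSum-suc`.
oddSum-suc : ∀ n → + (4 + 2 * n) ℤ.* oddSum (suc n) ℤ.+ + (18 * (5 + 4 * n)) ℤ.* evenSum n ≡
                   + (4 * (1 + 2 * n)) ℤ.* oddSum n
oddSum-suc n = begin
  + a ℤ.* (+ oddTerm (suc n) 0 - T) ℤ.+ + b ℤ.* evenSum n
    ≡⟨ expand (+ a) (+ oddTerm (suc n) 0) T (+ b ℤ.* evenSum n) ⟩
  + a ℤ.* + oddTerm (suc n) 0 - + a ℤ.* T ℤ.+ + b ℤ.* evenSum n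
    ≡⟨ cong₂ (λ u v → u - v ℤ.+ + b ℤ.* evenSum n)
         (trans (sym (ℤ.pos-* a (oddTerm (suc n) 0))) (trans (cong +_ (oddTerm-suc-0 n)) (ℤ.pos-* c (oddTerm n 0))))
         (alternatingSum-linear a b c (2 + n) (oddTerm (suc n) ∘ suc) (evenTerm n) (oddTerm n ∘ suc) (oddTerm-suc-suc n)) ⟩
  + c ℤ.* + oddTerm n 0 - (+ b ℤ.* evenSum n ℤ.+ + c ℤ.* T′) ℤ.+ + b ℤ.* evenSum n
    ≡⟨ collect (+ c) (+ oddTerm n 0) (+ b ℤ.* evenSum n) T′ ⟩
  + c ℤ.* alternatingSum (3 + n) (oddTerm n)
    ≡⟨ cong (λ z → + c ℤ.* z) (alternatingSum-last (2 + n) (oddTerm n) (oddTerm-vanishes n)) ⟩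
  + c ℤ.* oddSum n ∎
  where
  open ≡-Reasoning
  a = 4 + 2 * n
  b = 18 * (5 + 4 * n)
  c = 4 * (1 + 2 * n)
  T  = alternatingSum (2 + n) (oddTerm (suc n) ∘ suc)
  T′ = alternatingSum (2 + n) (oddTerm n ∘ suc)
  expand : ∀ a x t y → a ℤ.* (x - t) ℤ.+ y ≡ a ℤ.* x - a ℤ.* t ℤ.+ y
  expand = ℤSolver.solve-∀
  collect : ∀ c x y t → c ℤ.* x - (y ℤ.+ c ℤ.* t) ℤ.+ y ≡ c ℤ.* (x - t)
  collect = ℤSolver.solve-∀

evenSum-suc : ∀ n → + (5 + 2 * n) ℤ.* evenSum (suc n) ≡
  + (2 * (7 + 4 * n)) ℤ.* oddSum (suc n) ℤ.+ + (4 * (2 + 2 * n)) ℤ.* evenSum n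
evenSum-suc n = trans
  (alternatingSum-linear (5 + 2 * n) (2 * (7 + 4 * n)) (4 * (2 + 2 * n)) (3 + n)
    (evenTerm (suc n)) (oddTerm (suc n)) (evenTerm n) (evenTerm-suc n))
  (cong (λ z → + (2 * (7 + 4 * n)) ℤ.* oddSum (suc n) ℤ.+ + (4 * (2 + 2 * n)) ℤ.* z)
    (alternatingSum-last (2 + n) (evenTerm n) (evenTerm-vanishes n)))

-- Divisibility of the later terms

G-∣-suc : ∀ m k → G m k ∣ suc k * G m (suc k)
-- The quotient is m + 1 - k; adding k * G m k to the multiple avoids the subtraction.
G-∣-suc m k = ∣m+n∣m⇒∣n (divides (suc m) eq) (n∣m*n k)
  where
  eq : k * G m k + suc k * G m (suc k) ≡ suc m * G m k
  eq = trans (left k (catalan m) (suc m C k) (suc m C suc k))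
    (trans (cong (catalan m *_) (trans (cong (_+ k * (suc m C k)) (C-absorb m k)) (C-absorb′ m k)))
           (right m (catalan m) (suc m C k)))
    where
    left : ∀ k c x y → k * (c * x) + (1 + k) * (c * y) ≡ c * ((1 + k) * y + k * x)
    left = solve-∀
    right : ∀ m c x → c * ((1 + m) * x) ≡ (1 + m) * (c * x)
    right = solve-∀

-- One step along the sums raises m by 1 and k by 2. With the weight k! the quotient is the integer
-- 2(1+2m)(m+1-k).
k!G-∣-suc : ∀ m k → k ! * G m k ∣ (2 + k) ! * G (1 + m) (2 + k)
k!G-∣-suc m k = subst (k ! * G m k ∣_) (sym eq)
  (∣n⇒∣m*n (2 * (1 + 2 * m)) (*-monoʳ-∣ (k !) (G-∣-suc m k)))
  where
  eq : (2 + k) ! * G (1 + m) (2 + k) ≡ 2 * (1 + 2 * m) * (k ! * (suc k * G m (suc k)))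
  eq = trans (left k (k !) (G (1 + m) (2 + k))) (trans (cong (λ z → (1 + k) * k ! * z) (G-suc-suc m (suc k)))
       (right m k (k !) (G m (suc k))))
    where
    left : ∀ k f g → (2 + k) * ((1 + k) * f) * g ≡ (1 + k) * f * ((2 + k) * g)
    left = solve-∀
    right : ∀ m k f g → (1 + k) * f * (2 * (1 + 2 * m) * g) ≡ 2 * (1 + 2 * m) * (f * ((1 + k) * g))
    right = solve-∀

k!G-∣ : ∀ m k i → k ! * G m k ∣ (k + 2 * i) ! * G (m + i) (k + 2 * i)
k!G-∣ m k zero    = subst₂ (λ m′ k′ → k ! * G m k ∣ k′ ! * G m′ k′)
  (sym (+-identityʳ m)) (sym (+-identityʳ k)) ∣-refl
k!G-∣ m k (suc i) = subst₂ (λ m′ k′ → k ! * G m k ∣ k′ ! * G m′ k′)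
  (sym (+-suc m i)) (index k i) (∣-trans (k!G-∣ m k i) (k!G-∣-suc (m + i) (k + 2 * i)))
  where
  index : ∀ k i → 2 + (k + 2 * i) ≡ k + 2 * suc i
  index = solve-∀

-- The chain `k!G-∣` starts at k = 0, and at k = 1 in the even case. There k! = 1, so its start is
-- the first term itself and the weight burdens only the tail.
3^∥∣oddSum∣ : ∀ e n → 3 ^ e ∥ catalan n → 3 ^ e ∥ ∣ oddSum n ∣
3^∥∣oddSum∣ e n h@(u , eq , _) =
  ∥-subtract e (subst (3 ^ e ∥_) (sym (oddTerm-0 n)) h)
    (∣-alternatingSum (1 + n) (oddTerm n ∘ suc)
      λ i → 3^e∣N!h⇒3^[1+e]∣9^ih e i (2 * suc i) _ (n≤1+n _)
        (∣-trans 3^e∣ (k!G-∣ n 0 (suc i))))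
  where
  3^e∣ : 3 ^ e ∣ 1 * (catalan n * 1)
  3^e∣ = subst (3 ^ e ∣_) (trans (sym eq) (sym (trans (*-identityˡ _) (*-identityʳ _)))) (m∣m*n u)

evenTerm-0 : ∀ n → evenTerm n 0 ≡ 2 * ((1 + 2 * n) * catalan n)
evenTerm-0 n = trans (*-identityˡ (G (1 + n + 0) 1)) (trans (cong (λ m → G (suc m) 1) (+-identityʳ n))
  (trans (sym (*-identityˡ (G (1 + n) 1))) (trans (G-suc-suc n 0) (lemma n (catalan n)))))
  where
  lemma : ∀ n c → 2 * (1 + 2 * n) * (c * 1) ≡ 2 * ((1 + 2 * n) * c)
  lemma = solve-∀

3^∥∣evenSum∣ : ∀ e n → 3 ^ e ∥ evenTerm n 0 → 3 ^ e ∥ ∣ evenSum n ∣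
3^∥∣evenSum∣ e n h@(u , eq , _) =
  ∥-subtract e h (∣-alternatingSum (1 + n) (evenTerm n ∘ suc)
      λ i → 3^e∣N!h⇒3^[1+e]∣9^ih e i (1 + 2 * suc i) _ ≤-refl
        (∣-trans 3^e∣ (k!G-∣ (1 + n) 1 (suc i))))
  where
  3^e∣ : 3 ^ e ∣ 1 * G (1 + n) 1
  3^e∣ = subst (3 ^ e ∣_) (trans (sym eq) (cong (λ m → 1 * G (suc m) 1) (+-identityʳ n))) (m∣m*n u)

-- Identification of the sums with Schröder numbers

[-4]^_ : ℕ → ℤ
[-4]^ n = (- (+ 4)) ℤ.^ n

3∤[-4]^ : ∀ n → ¬ 3 ∣ ∣ [-4]^ n ∣
3∤[-4]^ zero    = from-no (3 ∣? 1)
3∤[-4]^ (suc n) 3∣ = [ from-no (3 ∣? 4) , 3∤[-4]^ n ]′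
  (euclidsLemma 4 ∣ [-4]^ n ∣ 3-prime (subst (3 ∣_) (ℤ.abs-* (- (+ 4)) ([-4]^ n)) 3∣))

-- Here p = (-4)^(n+1), the s are consecutive Schröder numbers, x and x′ are odd sums and y an even
-- one. With N the index of s₂, the coefficients a, b, c are N+1, N-2, 2N-1.
S-odd-step : ∀ a b c .{{_ : ℤ.NonZero a}} {p s₀ s₁ s₂ x y x′} →
  + 3 ℤ.* c ℤ.* s₁ ≡ a ℤ.* s₂ ℤ.+ b ℤ.* s₀ →
  p ℤ.* s₀ ≡ x → p ℤ.* (+ 2 ℤ.* s₁) ≡ + 3 ℤ.* y →
  a ℤ.* x′ ℤ.+ + 18 ℤ.* c ℤ.* y ≡ + 4 ℤ.* b ℤ.* x →
  - (+ 4) ℤ.* p ℤ.* s₂ ≡ x′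
S-odd-step a b c {p} {s₀} {s₁} {s₂} {x} {y} {x′} rec refl ps₁ eq = ℤ.*-cancelˡ-≡ a _ _ (begin
  a ℤ.* (- (+ 4) ℤ.* p ℤ.* s₂)                                ≡⟨ r₁ a b p s₀ s₂ ⟩
  + 4 ℤ.* b ℤ.* (p ℤ.* s₀) - + 4 ℤ.* p ℤ.* (a ℤ.* s₂ ℤ.+ b ℤ.* s₀)
    ≡⟨ cong₂ (λ u v → u - + 4 ℤ.* p ℤ.* v) eq rec ⟨
  (a ℤ.* x′ ℤ.+ + 18 ℤ.* c ℤ.* y) - + 4 ℤ.* p ℤ.* (+ 3 ℤ.* c ℤ.* s₁)
    ≡⟨ r₂ a c p s₁ x′ y ⟩
  a ℤ.* x′ ℤ.+ + 6 ℤ.* c ℤ.* (+ 3 ℤ.* y - p ℤ.* (+ 2 ℤ.* s₁))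
    ≡⟨ cong (λ z → a ℤ.* x′ ℤ.+ + 6 ℤ.* c ℤ.* (+ 3 ℤ.* y - z)) ps₁ ⟩
  a ℤ.* x′ ℤ.+ + 6 ℤ.* c ℤ.* (+ 3 ℤ.* y - + 3 ℤ.* y)
    ≡⟨ r₃ a c x′ y ⟩
  a ℤ.* x′ ∎)
  where
  open ≡-Reasoning
  r₁ : ∀ a b p s₀ s₂ → a ℤ.* (- (+ 4) ℤ.* p ℤ.* s₂) ≡
    + 4 ℤ.* b ℤ.* (p ℤ.* s₀) - + 4 ℤ.* p ℤ.* (a ℤ.* s₂ ℤ.+ b ℤ.* s₀)
  r₁ = ℤSolver.solve-∀
  r₂ : ∀ a c p s₁ x′ y → (a ℤ.* x′ ℤ.+ + 18 ℤ.* c ℤ.* y) - + 4 ℤ.* p ℤ.* (+ 3 ℤ.* c ℤ.* s₁) ≡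
    a ℤ.* x′ ℤ.+ + 6 ℤ.* c ℤ.* (+ 3 ℤ.* y - p ℤ.* (+ 2 ℤ.* s₁))
  r₂ = ℤSolver.solve-∀
  r₃ : ∀ a c x′ y → a ℤ.* x′ ℤ.+ + 6 ℤ.* c ℤ.* (+ 3 ℤ.* y - + 3 ℤ.* y) ≡ a ℤ.* x′
  r₃ = ℤSolver.solve-∀

S-even-step : ∀ a b c .{{_ : ℤ.NonZero a}} {p s₁ s₂ s₃ x′ y y′} →
  + 3 ℤ.* c ℤ.* s₂ ≡ a ℤ.* s₃ ℤ.+ b ℤ.* s₁ →
  p ℤ.* (+ 2 ℤ.* s₁) ≡ + 3 ℤ.* y → - (+ 4) ℤ.* p ℤ.* s₂ ≡ x′ →
  a ℤ.* y′ ≡ + 2 ℤ.* c ℤ.* x′ ℤ.+ + 4 ℤ.* b ℤ.* y →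
  - (+ 4) ℤ.* p ℤ.* (+ 2 ℤ.* s₃) ≡ + 3 ℤ.* y′
S-even-step a b c {p} {s₁} {s₂} {s₃} {x′} {y} {y′} rec ps₁ refl eq = ℤ.*-cancelˡ-≡ a _ _ (begin
  a ℤ.* (- (+ 4) ℤ.* p ℤ.* (+ 2 ℤ.* s₃))
    ≡⟨ r₁ a b p s₁ s₃ ⟩
  - (+ 8) ℤ.* p ℤ.* (a ℤ.* s₃ ℤ.+ b ℤ.* s₁) ℤ.+ + 4 ℤ.* b ℤ.* (p ℤ.* (+ 2 ℤ.* s₁))
    ≡⟨ cong₂ (λ u v → - (+ 8) ℤ.* p ℤ.* u ℤ.+ + 4 ℤ.* b ℤ.* v) (sym rec) ps₁ ⟩
  - (+ 8) ℤ.* p ℤ.* (+ 3 ℤ.* c ℤ.* s₂) ℤ.+ + 4 ℤ.* b ℤ.* (+ 3 ℤ.* y)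
    ≡⟨ r₂ b c p s₂ y ⟩
  + 3 ℤ.* (+ 2 ℤ.* c ℤ.* (- (+ 4) ℤ.* p ℤ.* s₂) ℤ.+ + 4 ℤ.* b ℤ.* y)
    ≡⟨ cong (λ z → + 3 ℤ.* z) eq ⟨
  + 3 ℤ.* (a ℤ.* y′)
    ≡⟨ r₃ a y′ ⟩
  a ℤ.* (+ 3 ℤ.* y′) ∎)
  where
  open ≡-Reasoning
  r₁ : ∀ a b p s₁ s₃ → a ℤ.* (- (+ 4) ℤ.* p ℤ.* (+ 2 ℤ.* s₃)) ≡
    - (+ 8) ℤ.* p ℤ.* (a ℤ.* s₃ ℤ.+ b ℤ.* s₁) ℤ.+ + 4 ℤ.* b ℤ.* (p ℤ.* (+ 2 ℤ.* s₁))
  r₁ = ℤSolver.solve-∀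
  r₂ : ∀ b c p s₂ y → - (+ 8) ℤ.* p ℤ.* (+ 3 ℤ.* c ℤ.* s₂) ℤ.+ + 4 ℤ.* b ℤ.* (+ 3 ℤ.* y) ≡
    + 3 ℤ.* (+ 2 ℤ.* c ℤ.* (- (+ 4) ℤ.* p ℤ.* s₂) ℤ.+ + 4 ℤ.* b ℤ.* y)
  r₂ = ℤSolver.solve-∀
  r₃ : ∀ a y → + 3 ℤ.* (a ℤ.* y) ≡ a ℤ.* (+ 3 ℤ.* y)
  r₃ = ℤSolver.solve-∀

S-recurrenceℤ : ∀ n c → 5 + 2 * n ≡ c →
  + 3 ℤ.* + c ℤ.* + S (2 + n) ≡ + (4 + n) ℤ.* + S (3 + n) ℤ.+ + (1 + n) ℤ.* + S (1 + n)
S-recurrenceℤ n _ refl = trans (cong (λ z → z ℤ.* + S (2 + n)) (sym (ℤ.pos-* 3 (5 + 2 * n))))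
  (pos-linear₂ (3 * (5 + 2 * n)) (4 + n) (1 + n) (S (2 + n)) (S (3 + n)) (S (1 + n)) (sym (S-recurrence n)))

-- The recurrence has order two and links the parities, so they are proved together. The power of -4
-- holds both 4^(n+1) and the sign that makes the first term positive; the even case has one 2 more.
S-explicit : ∀ n → [-4]^ suc n ℤ.* + S (1 + 2 * n) ≡ oddSum n
                 × [-4]^ suc n ℤ.* (+ 2 ℤ.* + S (2 + 2 * n)) ≡ + 3 ℤ.* evenSum n
-- By computation: both sides are -8 for S 1 = 2 and -48 for S 2 = 6.
S-explicit zero    = refl , refl
S-explicit (suc n) with S-explicit n
... | odd , even = subst (λ k → [-4]^ (2 + n) ℤ.* + S (1 + k) ≡ oddSum (suc n)) (sym (2*suc n)) odd′ ,
                   subst (λ k → [-4]^ (2 + n) ℤ.* (+ 2 ℤ.* + S (2 + k)) ≡ + 3 ℤ.* evenSum (suc n)) (sym (2*suc n)) even′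
  where
  c₁ : ∀ n → 5 + 2 * (2 * n) ≡ 5 + 4 * n
  c₁ = solve-∀
  c₂ : ∀ n → 5 + 2 * (1 + 2 * n) ≡ 7 + 4 * n
  c₂ = solve-∀
  odd′ : [-4]^ (2 + n) ℤ.* + S (3 + 2 * n) ≡ oddSum (suc n)
  odd′ = S-odd-step (+ (4 + 2 * n)) (+ (1 + 2 * n)) (+ (5 + 4 * n))
    {p = [-4]^ suc n} {s₀ = + S (1 + 2 * n)} {s₁ = + S (2 + 2 * n)} {s₂ = + S (3 + 2 * n)}
    (S-recurrenceℤ (2 * n) (5 + 4 * n) (c₁ n)) odd even
    (trans (cong (λ z → + (4 + 2 * n) ℤ.* oddSum (suc n) ℤ.+ z ℤ.* evenSum n) (sym (ℤ.pos-* 18 (5 + 4 * n))))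
      (trans (oddSum-suc n) (cong (λ z → z ℤ.* oddSum n) (ℤ.pos-* 4 (1 + 2 * n)))))
  even′ : [-4]^ (2 + n) ℤ.* (+ 2 ℤ.* + S (4 + 2 * n)) ≡ + 3 ℤ.* evenSum (suc n)
  even′ = S-even-step (+ (5 + 2 * n)) (+ (2 + 2 * n)) (+ (7 + 4 * n))
    {p = [-4]^ suc n} {s₁ = + S (2 + 2 * n)} {s₂ = + S (3 + 2 * n)} {s₃ = + S (4 + 2 * n)}
    (S-recurrenceℤ (1 + 2 * n) (7 + 4 * n) (c₂ n)) even odd′
    (trans (evenSum-suc n) (cong₂ (λ u v → u ℤ.* oddSum (suc n) ℤ.+ v ℤ.* evenSum n)
      (ℤ.pos-* 2 (7 + 4 * n)) (ℤ.pos-* 4 (2 + 2 * n))))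

-- Comparison of the valuations

theorem6 : ∀ (n : ℕ) →
    v₃ (S (2 * n + 1)) {{S-nonZero (2 * n + 1)}} ≡ v₃ (catalan n) {{catalan-nonZero n}}
    × v₃ (S (2 * n + 2)) {{S-nonZero (2 * n + 2)}} ≡ 1 + v₃ (1 + 2 * n) + v₃ (catalan n) {{catalan-nonZero n}}
-- The common integers are `oddSum n` and 3 times `evenSum n`; the factors -4 and 2 beside S are
-- prime to 3.
theorem6 n = ∥-unique 3-prime _ _ odd-left odd-right , ∥-unique 3-prime _ _ even-left even-right
  where
  instance
    _ = S-nonZero (2 * n + 1)
    _ = S-nonZero (2 * n + 2)
    _ = catalan-nonZero n
  vC = v₃ (catalan n)
  f = v₃ (1 + 2 * n) + vC

  3∤2 : ¬ 3 ∣ 2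
  3∤2 = from-no (3 ∣? 2)

  odd-left : 3 ^ v₃ (S (2 * n + 1)) ∥ ∣ oddSum n ∣
  odd-left = subst (3 ^ v₃ (S (2 * n + 1)) ∥_)
    (trans (sym (ℤ.abs-* ([-4]^ suc n) (+ S (2 * n + 1))))
      (cong ∣_∣ (trans (cong (λ k → [-4]^ suc n ℤ.* + S k) (+-comm (2 * n) 1)) (proj₁ (S-explicit n)))))
    (∥-* 3-prime 0 (v₃ (S (2 * n + 1))) (∤⇒p^0∥ 3-prime (3∤[-4]^ (suc n))) (n≢0⇒p^v∥n 3 (S (2 * n + 1))))

  odd-right : 3 ^ vC ∥ ∣ oddSum n ∣
  odd-right = 3^∥∣oddSum∣ vC n (n≢0⇒p^v∥n 3 (catalan n))

  even-left : 3 ^ v₃ (S (2 * n + 2)) ∥ ∣ + 3 ℤ.* evenSum n ∣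
  even-left = subst (3 ^ v₃ (S (2 * n + 2)) ∥_)
    (trans (cong (∣ [-4]^ suc n ∣ *_) (sym (ℤ.abs-* (+ 2) (+ S (2 * n + 2)))))
    (trans (sym (ℤ.abs-* ([-4]^ suc n) (+ 2 ℤ.* + S (2 * n + 2))))
      (cong ∣_∣ (trans (cong (λ k → [-4]^ suc n ℤ.* (+ 2 ℤ.* + S k)) (+-comm (2 * n) 2)) (proj₂ (S-explicit n))))))
    (∥-* 3-prime 0 (v₃ (S (2 * n + 2))) (∤⇒p^0∥ 3-prime (3∤[-4]^ (suc n)))
      (∥-* 3-prime 0 (v₃ (S (2 * n + 2))) (∤⇒p^0∥ 3-prime 3∤2) (n≢0⇒p^v∥n 3 (S (2 * n + 2)))))

  even-right : 3 ^ suc f ∥ ∣ + 3 ℤ.* evenSum n ∣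
  -- The outer 3 supplies the 1 of the formula; the first term 2(2n+1)C_n of the even sum supplies
  -- f, its 2 being prime to 3.
  even-right = subst (3 ^ suc f ∥_) (sym (ℤ.abs-* (+ 3) (evenSum n)))
    (∥-* 3-prime 1 f (1 , refl , from-no (3 ∣? 1))
      (3^∥∣evenSum∣ f n (subst (3 ^ f ∥_) (sym (evenTerm-0 n))
        (∥-* 3-prime 0 f (∤⇒p^0∥ 3-prime 3∤2)
          (∥-* 3-prime (v₃ (1 + 2 * n)) vC (n≢0⇒p^v∥n 3 (1 + 2 * n)) (n≢0⇒p^v∥n 3 (catalan n)))))))
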